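{- For every $f\in F(n)$ there exists a permutation $\sigma$ of $[n]$ that rearranges $f$ stably into an idempotent map $\iota\in I(n)$, i.e. $\iota(i)=f(\sigma(i))$ for $i=1,2,\ldots,n$; and such a $\sigma$ can be determined from $f$ (in an output array) in $\mathcal{O}(n)$ time using $2\log n$ bits.
   Context: $[n]=\{1,2,\ldots,n\}$. $F(n)$ is the set of all maps $f:[n]\to[n]$, and $I(n)\subseteq F(n)$ is the set of idempotent maps, i.e. those $\iota$ with $\iota(\iota(x))=\iota(x)$ for all $x\in[n]$. For $\iota\in I(n)$ and a fixed point $a$ of $\iota$, the index class of $a$ is $[a]_\iota=\{x\in[n]:\iota(x)=a\}$; $a\in[a]_\iota$ is its fixed index and the other members are its idle indices. "Stably" means that equal elements of $f$ keep their original order, where each class $[a]_\iota$ is read with the fixed index $a$ first, followed by its idle indices in increasing order: if $[a]_\iota$ is listed as $x_1=a$ followed by the idle indices $x_2<x_3<\cdots$, then $\sigma(x_1)<\sigma(x_2)<\sigma(x_3)<\cdots$. $f$ is stored in an array $D[1\ldots n]$ and $\sigma$ is written to an output array $E[1\ldots n]$. Computation is on a unit-cost random access machine; "$2\log n$ bits" means that besides these two arrays 2 auxiliary variables of $\log n$ bits each (indices or values of magnitude $O(n)$) are used. -}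

module Defs where

open import Algebra.Definitions using (IdempotentFun)
open import Data.Fin using (Fin; toℕ; _<_)
open import Data.Fin.Permutation using (Permutation′; _⟨$⟩ʳ_)
open import Data.List using (List; drop; head)
open import Data.Maybe using (Maybe; just)
import Data.Nat as ℕ
open import Data.Nat using (ℕ; zero; suc; _+_; _*_; _∸_; _≤_)
open import Data.Product using (_×_; ∃-syntax)
open import Data.Vec using (Vec; lookup; _[_]≔_)
open import Function using (_∘_)
open import Relation.Binary.PropositionalEquality using (_≡_; _≢_; _≗_)
open import Relation.Nullary using (¬_)

------------------------------------------------------------------------
-- Stable rearrangement into an idempotent map

-- The index set {1,…,n} is Fin n; the index i : Fin n has number
-- suc (toℕ i), which is how it appears in the arrays of the machine below.

F : ℕ → Set
F n = Fin n → Fin n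

IsIdempotent : ∀ {n} → F n → Set
IsIdempotent {n} = IdempotentFun (_≡_ {A = Fin n})

-- ι ⊢ x ≺ y : x and y lie in the same index class of ι, and x is listed
-- before y in it (fixed index first, then the idle indices, increasingly).

data _⊢_≺_ {n} (ι : F n) : Fin n → Fin n → Set where
  fixed≺idle : ∀ {a y} → ι a ≡ a → ι y ≡ a → y ≢ a → ι ⊢ a ≺ y
  idle≺idle  : ∀ {a x y} → ι a ≡ a → ι x ≡ a → x ≢ a → ι y ≡ a → y ≢ a →
               x < y → ι ⊢ x ≺ y

_RearrangesStably_Into_ : ∀ {n} → Permutation′ n → F n → F n → Set
σ RearrangesStably f Into ι =
  (ι ≗ f ∘ (σ ⟨$⟩ʳ_)) ×
  (∀ x y → ι ⊢ x ≺ y → σ ⟨$⟩ʳ x < σ ⟨$⟩ʳ y)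

RearrangesStablyIntoIdempotent : ∀ {n} → Permutation′ n → F n → Set
RearrangesStablyIntoIdempotent {n} σ f =
  ∃[ ι ] IsIdempotent {n} ι × σ RearrangesStably f Into ι

------------------------------------------------------------------------
-- Unit-cost random access machine with r auxiliary variables, a read-only
-- input array D[1…n] and a read-write output array E[1…n]

-- Operands are constants, n, variables, or array cells with (possibly
-- iterated) indirect addressing.  The nesting depth is fixed by the program,
-- so charging one unit per instruction is exact up to a constant factor.
-- Arithmetic does not nest, so that evaluation needs no hidden workspace.

data Operand (r : ℕ) : Set where
  const : ℕ → Operand r
  size  : Operand r
  var   : Fin r → Operand r
  D[_]  : Operand r → Operand r
  E[_]  : Operand r → Operand r

data Expr (r : ℕ) : Set where
  val     : Operand r → Expr r
  _⊞_ _⊟_ : Operand r → Operand r → Expr r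

data Test (r : ℕ) : Set where
  _≐_ _⋖_ : Operand r → Operand r → Test r

data Instr (r : ℕ) : Set where
  set    : Fin r → Expr r → Instr r
  storeE : Operand r → Expr r → Instr r
  jumpIf : Test r → ℕ → Instr r
  halt   : Instr r

Program : ℕ → Set
Program r = List (Instr r)

fetch : ∀ {r} → Program r → ℕ → Maybe (Instr r)
fetch P l = head (drop l P)

-- A variable holds a number from 0 to k * n.  A cell of E holds an index, or
-- 0 standing for "no index".

Var : (k n : ℕ) → Set
Var k n = Fin (suc (k * n))

Cell : ℕ → Set
Cell n = Fin (suc n)

record State (r k n : ℕ) : Set where
  constructor ⟨_,_,_⟩
  field
    pc   : ℕ
    vars : Vec (Var k n) r
    out  : Vec (Cell n) n

open State public

-- Evaluation is undefined when an array is accessed outside 1…n, and a step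
-- is undefined when the value to be written does not fit; such a machine is
-- stuck and does not count as halted.

module _ {r k n : ℕ} (f : F n) where

  data _⊢_⇓_ (s : State r k n) : Operand r → ℕ → Set where
    const⇓ : ∀ {c} → s ⊢ const c ⇓ c
    size⇓  : s ⊢ size ⇓ n
    var⇓   : ∀ {x} → s ⊢ var x ⇓ toℕ (lookup (vars s) x)
    D⇓     : ∀ {o} {i : Fin n} → s ⊢ o ⇓ suc (toℕ i) →
             s ⊢ D[ o ] ⇓ suc (toℕ (f i))
    E⇓     : ∀ {o} {i : Fin n} → s ⊢ o ⇓ suc (toℕ i) →
             s ⊢ E[ o ] ⇓ toℕ (lookup (out s) i)

  data _⊢_⇓ₑ_ (s : State r k n) : Expr r → ℕ → Set where
    val⇓ : ∀ {o u} → s ⊢ o ⇓ u → s ⊢ val o ⇓ₑ u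
    ⊞⇓   : ∀ {o p u v} → s ⊢ o ⇓ u → s ⊢ p ⇓ v → s ⊢ o ⊞ p ⇓ₑ (u + v)
    ⊟⇓   : ∀ {o p u v} → s ⊢ o ⇓ u → s ⊢ p ⇓ v → s ⊢ o ⊟ p ⇓ₑ (u ∸ v)

  data _⊢_true (s : State r k n) : Test r → Set where
    ≐-true : ∀ {o p u v} → s ⊢ o ⇓ u → s ⊢ p ⇓ v → u ≡ v →
             s ⊢ (o ≐ p) true
    ⋖-true : ∀ {o p u v} → s ⊢ o ⇓ u → s ⊢ p ⇓ v → u ℕ.< v →
             s ⊢ (o ⋖ p) true

  data _⊢_false (s : State r k n) : Test r → Set where
    ≐-false : ∀ {o p u v} → s ⊢ o ⇓ u → s ⊢ p ⇓ v → u ≢ v →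
              s ⊢ (o ≐ p) false
    ⋖-false : ∀ {o p u v} → s ⊢ o ⇓ u → s ⊢ p ⇓ v → ¬ (u ℕ.< v) →
              s ⊢ (o ⋖ p) false

  data Exec (s : State r k n) : Instr r → State r k n → Set where
    exec-set   : ∀ {x e} (u : Var k n) → s ⊢ e ⇓ₑ toℕ u →
                 Exec s (set x e) ⟨ suc (pc s) , vars s [ x ]≔ u , out s ⟩
    exec-store : ∀ {o e} {i : Fin n} (u : Cell n) →
                 s ⊢ o ⇓ suc (toℕ i) → s ⊢ e ⇓ₑ toℕ u →
                 Exec s (storeE o e) ⟨ suc (pc s) , vars s , out s [ i ]≔ u ⟩
    exec-jump  : ∀ {t l} → s ⊢ t true →
                 Exec s (jumpIf t l) ⟨ l , vars s , out s ⟩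
    exec-skip  : ∀ {t l} → s ⊢ t false →
                 Exec s (jumpIf t l) ⟨ suc (pc s) , vars s , out s ⟩

  -- Run P t s s′ : P leads from s to s′ in exactly t steps.

  data Run (P : Program r) : ℕ → State r k n → State r k n → Set where
    stop : ∀ {s} → Run P zero s s
    step : ∀ {t s s′ s″ ins} → fetch P (pc s) ≡ just ins → Exec s ins s′ →
           Run P t s′ s″ → Run P (suc t) s s″

Halted : ∀ {r k n} → Program r → State r k n → Set
Halted P s = fetch P (pc s) ≡ just halt

Holds : ∀ {n} → Vec (Cell n) n → Permutation′ n → Set
Holds {n} E σ = (i : Fin n) → toℕ (lookup E i) ≡ suc (toℕ (σ ⟨$⟩ʳ i))

-- The variables and the output array may initially contain anything.  T is
-- meant to be c * suc n with c independent of n and f: for n ≥ 1 this is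
-- O(n), and it still allows the machine to run when n = 0.

Determines : ∀ {r n} → Program r → (k T : ℕ) → F n → Permutation′ n → Set
Determines {r} {n} P k T f σ =
  (vars₀ : Vec (Var k n) r) (E₀ : Vec (Cell n) n) →
  ∃[ t ] ∃[ s ] t ≤ T × Run {k = k} f P t ⟨ 0 , vars₀ , E₀ ⟩ s ×
                Halted P s × Holds (out s) σ

{-# OPTIONS --safe #-}
module Submission where

-- The permutation sends each value a of f to the first position at which a
-- occurs in f, and sends the indices that are not values of f, in increasing
-- order, to the repeated positions (those at which a value occurs again), in
-- increasing order.  Then f (σ (f p)) ≡ f p for every p, so ι = f ∘ σ is
-- idempotent and its fixed points are the values of f.  Each class is stable:
-- the fixed index receives the first occurrence, and the idle indices, being
-- non-values, receive repeated positions monotonically.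
--
-- This σ needs no workspace beyond two counters.  After clearing E, a
-- descending pass storing i in E[D[i]] leaves the first occurrence of every
-- value in place (Collected) and 0 in exactly the cells that are not values.
-- An ascending pass then recognises a repeated position i by E[D[i]] ≠ i and
-- stores it in the next empty cell, found by a second counter j that never
-- moves back.  Cells E[D[i]] belong to values and are never overwritten, so
-- the test stays correct.  Both counters only advance, whence linear time.
--
-- No counting is needed to see that j finds an empty cell: if all cells were
-- filled, E would be an injective self-map of the indices omitting i, against
-- injective⇒surjective (room).  Likewise, once every position has been stored
-- somewhere, the map from positions to cells is injective, hence bijective,
-- and σ is its inverse (permutation-of).
--
-- σ must not depend on the initial contents of the memory.  The clearing pass
-- leads every initial state to one and the same state, and σ is read off the
-- run that starts there.

open import Defs
open import Data.Fin using (Fin; zero; suc; toℕ; fromℕ; fromℕ<; punchOut)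
import Data.Fin as Fin
open import Data.Fin.Permutation using (Permutation′; permutation; _⟨$⟩ʳ_)
open import Data.Fin.Properties
  using (toℕ-injective; toℕ-fromℕ; toℕ-fromℕ<; toℕ<n; suc-injective; any?; _≟_;
         <-cmp; punchOut-injective; injective⇒≤)
open import Data.List using ([]; _∷_)
open import Data.Maybe using (just)
open import Data.Nat using (ℕ; zero; suc; _+_; _*_; _≤_; _<_; z≤n; s≤s; z<s)
open import Data.Nat.Properties
  using (≤-refl; ≤-reflexive; ≤-trans; <-≤-trans; <⇒≤; <⇒≢; ≤∧≢⇒<;
         <-irrefl; n<1+n; m<n⇒m<1+n; m<1+n⇒m<n∨m≡n; m≤n⇒m<n∨m≡n; m≤m+n; m≤n+m;
         m<m+n; +-comm; +-suc; +-identityʳ; *-identityˡ)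
open import Data.Nat.Tactic.RingSolver using (solve-∀)
open import Data.Product
  using (Σ-syntax; ∃-syntax; _×_; _,_; proj₁; proj₂; map₂)
open import Data.Sum using (_⊎_; inj₁; inj₂)
open import Data.Vec using (Vec; []; _∷_; lookup; replicate; _[_]≔_)
open import Data.Vec.Properties
  using (lookup∘update; lookup∘update′; lookup-replicate)
open import Data.Vec.Relation.Binary.Pointwise.Extensional
  using (ext; Pointwise-≡⇒≡)
open import Function using (_∘_)
open import Function.Definitions using (Injective)
open import Relation.Binary.Definitions using (tri<; tri≈; tri>)
open import Relation.Binary.PropositionalEquality
  using (_≡_; _≢_; refl; sym; trans; cong; subst)
open import Relation.Nullary using (yes; no; contradiction)

------------------------------------------------------------------------
-- Finite sets and arrays

injective⇒surjective : ∀ {n} (g : Fin n → Fin n) → Injective _≡_ _≡_ g →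
                       ∀ y → ∃[ x ] g x ≡ y
injective⇒surjective {suc n} g inj y with any? (λ x → g x ≟ y)
... | yes hit = hit
... | no miss = contradiction
        (injective⇒≤ {f = λ x → punchOut (y≢g x)} λ {x} {x′} eq →
          inj (punchOut-injective (y≢g x) (y≢g x′) eq))
        (<-irrefl refl)
  where
  y≢g : ∀ x → y ≢ g x
  y≢g x eq = miss (x , sym eq)

-- The index whose number is one more than m.

index : ∀ {m n} → m < n → ∃[ p ] toℕ {n} p ≡ m
index m<n = fromℕ< m<n , toℕ-fromℕ< m<n

nonzero⇒suc : ∀ {n} {c : Fin (suc n)} → c ≢ zero → ∃[ p ] c ≡ suc p
nonzero⇒suc {c = zero}  c≢0 = contradiction refl c≢0
nonzero⇒suc {c = suc p} _   = p , refl

lookup-update : ∀ {A : Set} {n} (xs : Vec A n) x a y →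
                (y ≡ x × lookup (xs [ x ]≔ a) y ≡ a) ⊎
                (y ≢ x × lookup (xs [ x ]≔ a) y ≡ lookup xs y)
lookup-update xs x a y with y ≟ x
... | yes refl = inj₁ (refl , lookup∘update x xs a)
... | no  y≢x  = inj₂ (y≢x , lookup∘update′ y≢x xs a)

replicate-unique : ∀ {A : Set} {n} {a : A} {xs : Vec A n} →
                   (∀ y → lookup xs y ≡ a) → xs ≡ replicate n a
replicate-unique {a = a} all =
  Pointwise-≡⇒≡ (ext λ y → trans (all y) (sym (lookup-replicate y a)))

------------------------------------------------------------------------
-- Contents of the output array

module _ {n : ℕ} (f : F n) where

  -- y is not a value of f.

  Idle : Fin n → Set
  Idle y = ∀ p → f p ≢ y

  value⊎idle : ∀ y → (∃[ p ] f p ≡ y) ⊎ Idle y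
  value⊎idle y with any? (λ p → f p ≟ y)
  ... | yes hit = inj₁ hit
  ... | no miss = inj₂ λ p eq → miss (p , eq)

  -- The descending pass has treated the positions p with m ≤ toℕ p: at every
  -- value attained there, E holds an occurrence that none of them precedes,
  -- and E is empty at non-values.  For m = 0 the cells of the values hold
  -- exactly the first occurrences.

  record Collected (m : ℕ) (E : Vec (Cell n) n) : Set where
    field
      sound : ∀ {y q} → lookup E y ≡ suc q →
              f q ≡ y × (∀ r → m ≤ toℕ r → f r ≡ y → toℕ q ≤ toℕ r)
      found : ∀ p → m ≤ toℕ p → lookup E (f p) ≢ zero

  collected-none : Collected n (replicate n zero)
  collected-none = record
    { sound = λ {y} eq → contradiction
        (trans (sym (lookup-replicate y zero)) eq) λ ()
    ; found = λ p n≤p → contradiction (<-≤-trans (toℕ<n p) n≤p) (<-irrefl refl)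
    }

  collect : ∀ {m E p} → toℕ p ≡ m → Collected (suc m) E →
            Collected m (E [ f p ]≔ suc p)
  collect {m} {E} {p} refl C = record { sound = sound′ ; found = found′ }
    where
    open Collected C

    sound′ : ∀ {y q} → lookup (E [ f p ]≔ suc p) y ≡ suc q →
             f q ≡ y × (∀ r → m ≤ toℕ r → f r ≡ y → toℕ q ≤ toℕ r)
    sound′ {y} eq with lookup-update E (f p) (suc p) y
    ... | inj₁ (refl , new) with refl ← trans (sym new) eq =
          refl , λ r m≤r _ → m≤r
    ... | inj₂ (y≢fp , old) with sound (trans (sym old) eq)
    ...   | fq≡y , least = fq≡y , least′
      where
      least′ : ∀ r → m ≤ toℕ r → f r ≡ y → _ ≤ toℕ r
      least′ r m≤r fr≡y with m≤n⇒m<n∨m≡n m≤r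
      ... | inj₁ m<r = least r m<r fr≡y
      ... | inj₂ m≡r with refl ← toℕ-injective m≡r =
            contradiction (sym fr≡y) y≢fp

    found′ : ∀ r → m ≤ toℕ r → lookup (E [ f p ]≔ suc p) (f r) ≢ zero
    found′ r m≤r eq with lookup-update E (f p) (suc p) (f r)
    ... | inj₁ (_ , new) = contradiction (trans (sym new) eq) λ ()
    ... | inj₂ (fr≢fp , old) with m≤n⇒m<n∨m≡n m≤r
    ...   | inj₁ m<r = found r m<r (trans (sym old) eq)
    ...   | inj₂ m≡r with refl ← toℕ-injective m≡r = fr≢fp refl

  -- The ascending pass has treated the positions < m and scanned the cells
  -- < l: values keep their first occurrences, and the idle cells among the
  -- scanned ones hold the repeated positions among the treated ones, in
  -- increasing order.

  record Placed (m l : ℕ) (E : Vec (Cell n) n) : Set where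
    field
      leading    : ∀ p → ∃[ q ] lookup E (f p) ≡ suc q × f q ≡ f p ×
                         (∀ r → f r ≡ f p → toℕ q ≤ toℕ r)
      vacant     : ∀ {y} → Idle y → l ≤ toℕ y → lookup E y ≡ zero
      filled     : ∀ y → toℕ y < l → lookup E y ≢ zero
      treated    : ∀ {y p} → Idle y → lookup E y ≡ suc p → toℕ p < m
      repeated   : ∀ {y p} → Idle y → lookup E y ≡ suc p →
                   lookup E (f p) ≢ suc p
      increasing : ∀ {x y p q} → Idle x → Idle y → x Fin.< y →
                   lookup E x ≡ suc p → lookup E y ≡ suc q → p Fin.< q
      complete   : ∀ p → toℕ p < m → ∃[ y ] lookup E y ≡ suc p

  placed-none : ∀ {E} → Collected 0 E → Placed 0 0 E
  placed-none {E} C = record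
    { leading    = leading
    ; vacant     = λ idle _ → empty idle
    ; filled     = λ _ ()
    ; treated    = λ idle eq → absurd idle eq
    ; repeated   = λ idle eq → absurd idle eq
    ; increasing = λ idle _ _ eq → absurd idle eq
    ; complete   = λ _ ()
    }
    where
    open Collected C

    leading : ∀ p → ∃[ q ] lookup E (f p) ≡ suc q × f q ≡ f p ×
                    (∀ r → f r ≡ f p → toℕ q ≤ toℕ r)
    leading p with nonzero⇒suc (found p z≤n)
    ... | q , eq = q , eq , proj₁ (sound eq) , λ r → proj₂ (sound eq) r z≤n

    absurd : ∀ {A : Set} {y q} → Idle y → lookup E y ≡ suc q → A
    absurd idle eq = contradiction (proj₁ (sound eq)) (idle _)

    empty : ∀ {y} → Idle y → lookup E y ≡ zero
    empty {y} idle with lookup E y in eq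
    ... | zero  = refl
    ... | suc q = absurd idle eq

  module _ {m l : ℕ} {E : Vec (Cell n) n} (Pl : Placed m l E) where
    open Placed Pl

    empty⇒idle : ∀ {y} → lookup E y ≡ zero → Idle y
    empty⇒idle empty p refl with leading p
    ... | _ , eq , _ = contradiction (trans (sym empty) eq) λ ()

    value-or-idle-cell : ∀ {y p} → lookup E y ≡ suc p → y ≡ f p ⊎ Idle y
    value-or-idle-cell {y} eq with value⊎idle y
    ... | inj₂ idle = inj₂ idle
    ... | inj₁ (r , refl) with leading r
    ...   | q , eq′ , fq≡fr , _ with refl ← trans (sym eq) eq′ =
            inj₁ (sym fq≡fr)

    cell-unique : ∀ {x y p} → lookup E x ≡ suc p → lookup E y ≡ suc p → x ≡ y
    cell-unique {x} {y} ex ey with value-or-idle-cell ex | value-or-idle-cell ey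
    ... | inj₁ refl | inj₁ refl = refl
    ... | inj₁ refl | inj₂ idle = contradiction ex (repeated idle ey)
    ... | inj₂ idle | inj₁ refl = contradiction ey (repeated idle ex)
    ... | inj₂ idx  | inj₂ idy with <-cmp x y
    ...   | tri< x<y _ _ =
            contradiction (increasing idx idy x<y ex ey) (<-irrefl refl)
    ...   | tri≈ _ x≡y _ = x≡y
    ...   | tri> _ _ y<x =
            contradiction (increasing idy idx y<x ey ex) (<-irrefl refl)

    -- The position p to be placed is still absent from E, so that E cannot be
    -- full.

    room : ∀ {p} → toℕ p ≡ m → lookup E (f p) ≢ suc p → l ≢ n
    room {p} p≡m rep refl = missing (injective⇒surjective content content-inj p)
      where
      full : ∀ y → ∃[ q ] lookup E y ≡ suc q
      full y = nonzero⇒suc (filled y (toℕ<n y))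

      content : Fin n → Fin n
      content y = proj₁ (full y)

      content-inj : Injective _≡_ _≡_ content
      content-inj {x} {y} eq =
        cell-unique (proj₂ (full x)) (trans (proj₂ (full y)) (cong suc (sym eq)))

      missing : ∃[ y ] content y ≡ p → _
      missing (y , refl) with value-or-idle-cell (proj₂ (full y))
      ... | inj₁ y≡fp = rep (subst (λ z → lookup E z ≡ _) y≡fp (proj₂ (full y)))
      ... | inj₂ idle = <⇒≢ (treated idle (proj₂ (full y))) p≡m

    skip-first : ∀ {p} → toℕ p ≡ m → lookup E (f p) ≡ suc p →
                 Placed (suc m) l E
    skip-first {p} refl eq = record
      { leading    = leading
      ; vacant     = vacant
      ; filled     = filled
      ; treated    = λ idle e → m<n⇒m<1+n (treated idle e)
      ; repeated   = repeated
      ; increasing = increasing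
      ; complete   = complete′
      }
      where
      complete′ : ∀ r → toℕ r < suc m → ∃[ y ] lookup E y ≡ suc r
      complete′ r r<1+m with m<1+n⇒m<n∨m≡n r<1+m
      ... | inj₁ r<m = complete r r<m
      ... | inj₂ r≡m with refl ← toℕ-injective r≡m = f p , eq

    skip-filled : ∀ {y} → toℕ y ≡ l → lookup E y ≢ zero → Placed m (suc l) E
    skip-filled {y} refl nonempty = record
      { leading    = leading
      ; vacant     = λ idle l<z → vacant idle (<⇒≤ l<z)
      ; filled     = filled′
      ; treated    = treated
      ; repeated   = repeated
      ; increasing = increasing
      ; complete   = complete
      }
      where
      filled′ : ∀ z → toℕ z < suc l → lookup E z ≢ zero
      filled′ z z<1+l with m<1+n⇒m<n∨m≡n z<1+l
      ... | inj₁ z<l = filled z z<l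
      ... | inj₂ z≡l with refl ← toℕ-injective z≡l = nonempty

    place-repeated : ∀ {p y} → toℕ p ≡ m → toℕ y ≡ l →
                     lookup E (f p) ≢ suc p → lookup E y ≡ zero →
                     Placed (suc m) (suc l) (E [ y ]≔ suc p)
    place-repeated {p} {y} refl refl rep empty = record
      { leading    = λ r → let q , eq , rest = leading r in
                     q , trans (value-kept r) eq , rest
      ; vacant     = vacant′
      ; filled     = filled′
      ; treated    = treated′
      ; repeated   = repeated′
      ; increasing = increasing′
      ; complete   = complete′
      }
      where
      E′ : Vec (Cell n) n
      E′ = E [ y ]≔ suc p

      y-idle : Idle y
      y-idle = empty⇒idle empty

      value-kept : ∀ r → lookup E′ (f r) ≡ lookup E (f r)
      value-kept r = lookup∘update′ (y-idle r) E (suc p)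

      -- The contents of a cell are either new or old.
      origin : ∀ {z q} → lookup E′ z ≡ suc q →
               (z ≡ y × q ≡ p) ⊎ lookup E z ≡ suc q
      origin {z} eq with lookup-update E y (suc p) z
      ... | inj₁ (z≡y , new) = inj₁ (z≡y , suc-injective (trans (sym eq) new))
      ... | inj₂ (_   , old) = inj₂ (trans (sym old) eq)

      vacant′ : ∀ {z} → Idle z → suc l ≤ toℕ z → lookup E′ z ≡ zero
      vacant′ {z} idle l<z with lookup-update E y (suc p) z
      ... | inj₁ (refl , _) = contradiction l<z (<-irrefl refl)
      ... | inj₂ (_  , old) = trans old (vacant idle (<⇒≤ l<z))

      filled′ : ∀ z → toℕ z < suc l → lookup E′ z ≢ zero
      filled′ z z<1+l eq with lookup-update E y (suc p) z
      ... | inj₁ (_ , new) = contradiction (trans (sym new) eq) λ ()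
      ... | inj₂ (z≢y , old) with m<1+n⇒m<n∨m≡n z<1+l
      ...   | inj₁ z<l = filled z z<l (trans (sym old) eq)
      ...   | inj₂ z≡l = z≢y (toℕ-injective z≡l)

      treated′ : ∀ {z q} → Idle z → lookup E′ z ≡ suc q → toℕ q < suc m
      treated′ idle eq with origin eq
      ... | inj₁ (_ , refl) = n<1+n _
      ... | inj₂ old        = m<n⇒m<1+n (treated idle old)

      repeated′ : ∀ {z q} → Idle z → lookup E′ z ≡ suc q →
                  lookup E′ (f q) ≢ suc q
      repeated′ {q = q} idle eq first with origin eq
      ... | inj₁ (_ , refl) = rep (trans (sym (value-kept q)) first)
      ... | inj₂ old = repeated idle old (trans (sym (value-kept q)) first)

      increasing′ : ∀ {x z q r} → Idle x → Idle z → x Fin.< z →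
                    lookup E′ x ≡ suc q → lookup E′ z ≡ suc r → q Fin.< r
      increasing′ idx idz x<z ex ez with origin ex | origin ez
      ... | inj₁ (refl , _) | inj₁ (refl , _) =
            contradiction x<z (<-irrefl refl)
      -- Idle cells beyond y are still empty.
      ... | inj₁ (refl , _) | inj₂ old =
            contradiction (trans (sym (vacant idz (<⇒≤ x<z))) old) λ ()
      ... | inj₂ old | inj₁ (_ , refl) = treated idx old
      ... | inj₂ old | inj₂ old′       = increasing idx idz x<z old old′

      complete′ : ∀ r → toℕ r < suc m → ∃[ z ] lookup E′ z ≡ suc r
      complete′ r r<1+m with m<1+n⇒m<n∨m≡n r<1+m
      ... | inj₂ r≡m with refl ← toℕ-injective r≡m = y , lookup∘update y E _
      ... | inj₁ r<m with complete r r<m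
      ...   | z , eq with lookup-update E y (suc p) z
      ...     | inj₁ (refl , _) = contradiction (trans (sym empty) eq) λ ()
      ...     | inj₂ (_  , old) = z , trans old eq

  -- Once all positions are placed, E is a permutation.

  module _ {l : ℕ} {E : Vec (Cell n) n} (Pl : Placed n l E) where
    open Placed Pl

    cell-of : Fin n → Fin n
    cell-of p = proj₁ (complete p (toℕ<n p))

    lookup-cell-of : ∀ p → lookup E (cell-of p) ≡ suc p
    lookup-cell-of p = proj₂ (complete p (toℕ<n p))

    cell-of-injective : Injective _≡_ _≡_ cell-of
    cell-of-injective {p} {q} eq = suc-injective (trans
      (sym (lookup-cell-of p)) (trans (cong (lookup E) eq) (lookup-cell-of q)))

    cell-of-surjective : ∀ y → ∃[ p ] cell-of p ≡ y
    cell-of-surjective = injective⇒surjective cell-of cell-of-injective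

    permutation-of : Permutation′ n
    permutation-of = permutation (proj₁ ∘ cell-of-surjective) cell-of
      (λ p → cell-of-injective (proj₂ (cell-of-surjective (cell-of p))))
      (proj₂ ∘ cell-of-surjective)

    private
      σ : Fin n → Fin n
      σ = permutation-of ⟨$⟩ʳ_

    lookup-σ : ∀ y → lookup E y ≡ suc (σ y)
    lookup-σ y = subst (λ z → lookup E z ≡ suc (σ y))
      (proj₂ (cell-of-surjective y)) (lookup-cell-of (σ y))

    holds : Holds E permutation-of
    holds y = cong toℕ (lookup-σ y)

    σ-injective : ∀ {x y} → σ x ≡ σ y → x ≡ y
    σ-injective {x} {y} eq = cell-unique Pl
      (lookup-σ x) (trans (lookup-σ y) (cong suc (sym eq)))

    σ-first : ∀ p → f (σ (f p)) ≡ f p × (∀ r → f r ≡ f p → toℕ (σ (f p)) ≤ toℕ r)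
    σ-first p with leading p
    ... | q , eq , first with refl ← trans (sym (lookup-σ (f p))) eq = first

    -- An index that f ∘ σ moves is not a value of f.
    moved⇒idle : ∀ {y} → f (σ y) ≢ y → Idle y
    moved⇒idle moved p refl = moved (proj₁ (σ-first p))

    rearranges-stably : RearrangesStablyIntoIdempotent permutation-of f
    rearranges-stably =
      f ∘ σ , (λ x → proj₁ (σ-first (σ x))) , (λ _ → refl) , stable
      where
      stable : ∀ x y → (f ∘ σ) ⊢ x ≺ y → σ x Fin.< σ y
      stable a y (fixed≺idle fixed y∈a y≢a) = ≤∧≢⇒<
        (subst (λ z → toℕ (σ z) ≤ toℕ (σ y)) fixed
          (proj₂ (σ-first (σ a)) (σ y) (trans y∈a (sym fixed))))
        (λ eq → y≢a (sym (σ-injective (toℕ-injective eq))))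
      stable x y (idle≺idle _ x∈a x≢a y∈a y≢a x<y) = increasing
        (moved⇒idle λ eq → x≢a (trans (sym eq) x∈a))
        (moved⇒idle λ eq → y≢a (trans (sym eq) y∈a))
        x<y (lookup-σ x) (lookup-σ y)

------------------------------------------------------------------------
-- The program

-- The clearing, descending and ascending passes start at 2, 6 and 10.

rearrange : Program 2
rearrange =
  set j (val (const 0)) ∷                       -- 0
  set i (val (const 0)) ∷                       -- 1
  jumpIf (var i ≐ size) 6 ∷                     -- 2
  set i (var i ⊞ const 1) ∷                     -- 3
  storeE (var i) (val (const 0)) ∷              -- 4
  jumpIf (const 0 ≐ const 0) 2 ∷                -- 5
  jumpIf (var i ≐ const 0) 10 ∷                 -- 6
  storeE D[ var i ] (val (var i)) ∷             -- 7
  set i (var i ⊟ const 1) ∷                     -- 8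
  jumpIf (const 0 ≐ const 0) 6 ∷                -- 9
  jumpIf (var i ≐ size) 17 ∷                    -- 10
  set i (var i ⊞ const 1) ∷                     -- 11
  jumpIf (E[ D[ var i ] ] ≐ var i) 10 ∷         -- 12
  set j (var j ⊞ const 1) ∷                     -- 13
  jumpIf (const 0 ⋖ E[ var j ]) 13 ∷            -- 14
  storeE (var j) (val (var i)) ∷                -- 15
  jumpIf (const 0 ≐ const 0) 10 ∷               -- 16
  halt ∷ []                                     -- 17
  where
  i j : Fin 2
  i = zero
  j = suc zero

------------------------------------------------------------------------
-- Correctness and running time

module _ {n : ℕ} (f : F n) where

  -- Within T steps the program leads from s to a state satisfying Q.

  Reaches : ℕ → State 2 1 n → (State 2 1 n → Set) → Set
  Reaches T s Q = ∃[ t ] ∃[ s′ ] t ≤ T × Run f rearrange t s s′ × Q s′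

  module _ {Q : State 2 1 n → Set} where

    before : ∀ {T s s′ ins} → fetch rearrange (pc s) ≡ just ins →
             Exec f s ins s′ → Reaches T s′ Q → Reaches (suc T) s Q
    before at exec (t , s″ , t≤T , run , q) =
      suc t , s″ , s≤s t≤T , step at exec run , q

    relax : ∀ {T T′ s} → T ≤ T′ → Reaches T s Q → Reaches T′ s Q
    relax T≤T′ (t , s″ , t≤T , rest) = t , s″ , ≤-trans t≤T T≤T′ , rest

    assign : ∀ {T s x e v} → fetch rearrange (pc s) ≡ just (set x e) →
             _⊢_⇓ₑ_ f s e v → v ≤ n →
             (∀ u → toℕ u ≡ v →
               Reaches T ⟨ suc (pc s) , vars s [ x ]≔ u , out s ⟩ Q) →
             Reaches (suc T) s Q
    assign {s = s} {e = e} at eval v≤n next =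
      before at (exec-set u (subst (_⊢_⇓ₑ_ f s e) (sym u≡v) eval)) (next u u≡v)
      where
      v<1+1*n = s≤s (≤-trans v≤n (≤-reflexive (sym (*-identityˡ n))))
      u       = fromℕ< v<1+1*n
      u≡v     = toℕ-fromℕ< v<1+1*n

    loop : ∀ {T s l} →
           fetch rearrange (pc s) ≡ just (jumpIf (const 0 ≐ const 0) l) →
           Reaches T ⟨ l , vars s , out s ⟩ Q → Reaches (suc T) s Q
    loop at = before at (exec-jump (≐-true const⇓ const⇓ refl))

  var⇓′ : ∀ {s : State 2 1 n} {x m} → toℕ (lookup (vars s) x) ≡ m →
          _⊢_⇓_ f s (var x) m
  var⇓′ refl = var⇓

  below : ∀ {m d} → m + suc d ≡ n → m < n
  below {m} eq = subst (m <_) eq (m<m+n m z<s)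

  advance : ∀ {m d} → m + suc d ≡ n → suc m + d ≡ n
  advance {m} {d} eq = trans (sym (+-suc m d)) eq

  successor : ∀ {u m} → u ≡ m + 1 → u ≡ suc m
  successor {m = m} eq = trans eq (+-comm m 1)

  successor-fits : ∀ {m} → m < n → m + 1 ≤ n
  successor-fits {m} m<n = subst (_≤ n) (+-comm 1 m) m<n

  -- The state after clearing, whatever the memory held initially.

  cleared : State 2 1 n
  cleared = ⟨ 6 , fromℕ (1 * n) ∷ zero ∷ [] , replicate n zero ⟩

  run-clear : ∀ {Q T} d m {i E} → toℕ i ≡ m → m + d ≡ n →
              (∀ y → toℕ y < m → lookup E y ≡ zero) →
              Reaches T cleared Q →
              Reaches (d * 4 + suc T) ⟨ 2 , i ∷ zero ∷ [] , E ⟩ Q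
  run-clear {Q} {T} zero m {i} {E} i≡m m+0≡n empty next =
    before refl (exec-jump (≐-true (var⇓′ i≡n) size⇓ refl))
      (subst (λ s → Reaches T s Q) (sym eq) next)
    where
    m≡n : m ≡ n
    m≡n = trans (sym (+-identityʳ m)) m+0≡n

    i≡n : toℕ i ≡ n
    i≡n = trans i≡m m≡n

    i≡max : i ≡ fromℕ (1 * n)
    i≡max = toℕ-injective
      (trans i≡n (trans (sym (*-identityˡ n)) (sym (toℕ-fromℕ (1 * n)))))

    E≡0 : E ≡ replicate n zero
    E≡0 = replicate-unique λ y →
      empty y (subst (toℕ y <_) (sym m≡n) (toℕ<n y))

    eq : ⟨ 6 , i ∷ zero ∷ [] , E ⟩ ≡ cleared
    eq rewrite i≡max | E≡0 = refl
  run-clear (suc d) m {i} {E} i≡m m+d≡n empty next with index (below m+d≡n)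
  ... | p , refl =
    before refl (exec-skip (≐-false (var⇓′ i≡m) size⇓ (<⇒≢ (below m+d≡n)))) (
    assign refl (⊞⇓ (var⇓′ i≡m) const⇓) (successor-fits (below m+d≡n)) λ u u≡ →
    before refl (exec-store zero (var⇓′ (successor u≡)) (val⇓ const⇓)) (
    loop refl (run-clear d (suc m) (successor u≡) (advance m+d≡n) empty′ next)))
    where
    empty′ : ∀ y → toℕ y < suc m → lookup (E [ p ]≔ zero) y ≡ zero
    empty′ y y<1+m with lookup-update E p zero y
    ... | inj₁ (_ , new) = new
    ... | inj₂ (y≢p , old) with m<1+n⇒m<n∨m≡n y<1+m
    ...   | inj₁ y<m = trans old (empty y y<m)
    ...   | inj₂ y≡m = contradiction (toℕ-injective y≡m) y≢p

  run-collect : ∀ {Q T} m {i E} → toℕ i ≡ m → m ≤ n → Collected f m E →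
                (∀ {i E} → toℕ i ≡ 0 → Collected f 0 E →
                  Reaches T ⟨ 10 , i ∷ zero ∷ [] , E ⟩ Q) →
                Reaches (m * 4 + suc T) ⟨ 6 , i ∷ zero ∷ [] , E ⟩ Q
  run-collect zero i≡0 _ C next =
    before refl (exec-jump (≐-true (var⇓′ i≡0) const⇓ refl)) (next i≡0 C)
  run-collect (suc m) i≡ m<n C next with index m<n
  ... | p , refl =
    before refl (exec-skip (≐-false (var⇓′ i≡) const⇓ λ ())) (
    before refl (exec-store (suc p) (D⇓ (var⇓′ i≡)) (val⇓ (var⇓′ i≡))) (
    assign refl (⊟⇓ (var⇓′ i≡) const⇓) (<⇒≤ m<n) λ u u≡ →
    loop refl (run-collect m u≡ (<⇒≤ m<n) (collect f refl C) next)))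

  Finished : State 2 1 n → Set
  Finished s = Halted rearrange s × ∃[ l ] Placed f n l (out s)

  -- a positions and b cells are left.  Each position costs at most five steps
  -- (three to test it, two to store it and jump back), each scanned cell two,
  -- and the last step leaves the loop.

  run-place : ∀ a b m l {i j E} → toℕ i ≡ m → toℕ j ≡ l →
              m + a ≡ n → l + b ≡ n → Placed f m l E →
              Reaches (a * 5 + suc (b * 2)) ⟨ 10 , i ∷ j ∷ [] , E ⟩ Finished
  run-scan  : ∀ a b l {i j E} p → toℕ i ≡ suc (toℕ p) → toℕ j ≡ l →
              suc (toℕ p) + a ≡ n → l + b ≡ n → Placed f (toℕ p) l E →
              lookup E (f p) ≢ suc p →
              Reaches (2 + (a * 5 + suc (b * 2)))
                      ⟨ 13 , i ∷ j ∷ [] , E ⟩ Finished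

  run-place zero b m l {i} {j} {E} i≡m _ m+0≡n _ Pl =
    before refl (exec-jump (≐-true (var⇓′ i≡m) size⇓ m≡n))
      (0 , _ , z≤n , stop , refl , l , subst (λ k → Placed f k l E) m≡n Pl)
    where
    m≡n : m ≡ n
    m≡n = trans (sym (+-identityʳ m)) m+0≡n
  run-place (suc a) b m l {i} {j} {E} i≡m j≡l m+a≡n l+b≡n Pl
    with index (below m+a≡n)
  ... | p , refl =
    before refl (exec-skip (≐-false (var⇓′ i≡m) size⇓ (<⇒≢ (below m+a≡n)))) (
    assign refl (⊞⇓ (var⇓′ i≡m) const⇓) (successor-fits (below m+a≡n)) λ u u≡ →
    treat u (successor u≡))
    where
    treat : ∀ u → toℕ u ≡ suc m →
            Reaches (3 + (a * 5 + suc (b * 2))) ⟨ 12 , u ∷ j ∷ [] , E ⟩ Finished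
    treat u u≡ with lookup E (f p) ≟ suc p
    ... | yes first =
      before refl (exec-jump
        (≐-true (E⇓ (D⇓ (var⇓′ u≡))) (var⇓′ u≡) (cong toℕ first))) (
      relax (m≤n+m _ 2)
        (run-place a b (suc m) l u≡ j≡l (advance m+a≡n) l+b≡n
          (skip-first f Pl refl first)))
    ... | no rep =
      before refl (exec-skip
        (≐-false (E⇓ (D⇓ (var⇓′ u≡))) (var⇓′ u≡) (rep ∘ toℕ-injective)))
        (run-scan a b l p u≡ j≡l (advance m+a≡n) l+b≡n Pl rep)

  run-scan a zero l p _ _ _ l+0≡n Pl rep =
    contradiction (trans (sym (+-identityʳ l)) l+0≡n) (room f Pl refl rep)
  run-scan a (suc b) l {i} {j} {E} p i≡ j≡l p+a≡n l+b≡n Pl rep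
    with index (below l+b≡n)
  ... | y , refl =
    relax (≤-reflexive (cong (2 +_) (sym (shift (a * 5) (suc (b * 2)))))) (
    assign refl (⊞⇓ (var⇓′ j≡l) const⇓) (successor-fits (below l+b≡n)) λ v v≡ →
    inspect v (successor v≡))
    where
    shift : ∀ x z → x + (2 + z) ≡ 2 + (x + z)
    shift = solve-∀

    inspect : ∀ v → toℕ v ≡ suc l →
              Reaches (3 + (a * 5 + suc (b * 2)))
                      ⟨ 14 , i ∷ v ∷ [] , E ⟩ Finished
    inspect v v≡ with lookup E y in eq
    ... | suc q =
      before refl (exec-jump
        (⋖-true const⇓ (E⇓ (var⇓′ v≡)) (subst (λ c → 0 < toℕ c) (sym eq) z<s)))
        (run-scan a b (suc l) p i≡ v≡ p+a≡n (advance l+b≡n)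
          (skip-filled f Pl refl λ empty →
            contradiction (trans (sym eq) empty) λ ()) rep)
    ... | zero =
      before refl (exec-skip
        (⋖-false const⇓ (E⇓ (var⇓′ v≡)) λ 0<c →
          contradiction (subst (λ c → 0 < toℕ c) eq 0<c) λ ())) (
      before refl (exec-store (suc p) (var⇓′ v≡) (val⇓ (var⇓′ i≡))) (
      loop refl (run-place a b (suc (toℕ p)) (suc l) i≡ v≡ p+a≡n (advance l+b≡n)
        (place-repeated f Pl refl refl rep eq))))

  -- The budget of the second and third pass.

  budget : ℕ
  budget = n * 4 + suc (n * 5 + suc (n * 2))

  run-cleared : Reaches budget cleared Finished
  run-cleared =
    run-collect n (trans (toℕ-fromℕ (1 * n)) (*-identityˡ n)) ≤-refl
      (collected-none f)
      (λ i≡0 C → run-place n n 0 0 i≡0 refl refl refl (placed-none f C))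

  run-initial : ∀ {Q} vars₀ E₀ → Reaches budget cleared Q →
                Reaches (2 + (n * 4 + suc budget)) ⟨ 0 , vars₀ , E₀ ⟩ Q
  run-initial (_ ∷ _ ∷ []) E₀ next =
    before refl (exec-set zero (val⇓ const⇓)) (
    before refl (exec-set zero (val⇓ const⇓)) (
    run-clear n 0 refl refl (λ _ ()) next))

  budget-linear : 2 + (n * 4 + suc budget) ≤ 15 * suc n
  budget-linear = subst (2 + (n * 4 + suc budget) ≤_) (total n) (m≤m+n _ 10)
    where
    total : ∀ n → 2 + (n * 4 + suc (n * 4 + suc (n * 5 + suc (n * 2)))) + 10
                  ≡ 15 * suc n
    total = solve-∀

  rearrange-correct :
    Σ[ σ ∈ Permutation′ n ]
      (RearrangesStablyIntoIdempotent σ f ×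
       Determines rearrange 1 (15 * suc n) f σ)
  rearrange-correct with run-cleared
  ... | t , s , t≤ , run , halted , l , Pl =
    permutation-of f Pl , rearranges-stably f Pl , λ vars₀ E₀ →
      relax budget-linear
        (run-initial vars₀ E₀ (t , s , t≤ , run , halted , holds f Pl))

theorem2p7 : ((n : ℕ) (f : F n) →
    Σ[ σ ∈ Permutation′ n ] RearrangesStablyIntoIdempotent σ f)
    ×
    (Σ[ P ∈ Program 2 ] ∃[ k ] ∃[ c ]
    ((n : ℕ) (f : F n) →
    Σ[ σ ∈ Permutation′ n ]
    (RearrangesStablyIntoIdempotent σ f ×
    Determines P k (c * suc n) f σ)))
theorem2p7 =
  (λ n f → map₂ proj₁ (rearrange-correct f)) ,
  rearrange , 1 , 15 , λ n f → rearrange-correct f
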